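{- For every integer $n\ge 2$ and every $s\in\mathbb{N}$, $\mathrm{ML}(1,2,\ldots,n-1,ns)=\frac{s}{ns+1}$.
   Context: For a real number $x$, $\Vert x\Vert$ denotes the distance from $x$ to the nearest integer. For positive integers $v_1,\ldots,v_n$, the maximum loneliness is $\mathrm{ML}(v_1,\ldots,v_n)=\max_{t\in\mathbb{R}}\min_{1\le i\le n}\Vert t v_i\Vert$. Here $\mathbb{N}=\{1,2,3,\ldots\}$. -}

module Defs where

open import Data.Bool.Base using (true; false)
open import Data.Integer.Base as ℤ using (ℤ; +_; 1ℤ)
import Data.Integer.DivMod as ℤ
import Data.Integer.Properties as ℤ
open import Data.List.NonEmpty.Base using (List⁺; map; foldr₁)
open import Data.Nat.Base as ℕ using (ℕ)
import Data.Nat.Properties as ℕ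
open import Data.Nat.Coprimality using (Coprime; sym; 1-coprimeTo)
open import Data.Product.Base using (_×_; ∃; _,_; proj₁; proj₂)
open import Data.Rational.Base as ℚ using (ℚ; mkℚ; 0ℚ; 1ℚ; ½; *≤*; *<*; floor; ceiling; round)
open import Data.Rational.Properties as ℚ using (module ≤-Reasoning)
open import Data.Rational.Solver using (module +-*-Solver)
open import Data.Sum.Base using (inj₁; inj₂)
open import Relation.Binary.Definitions using (Tri; tri<; tri≈; tri>)
open import Relation.Binary.PropositionalEquality as ≡ using (_≡_; refl; cong; cong₂; subst; subst₂)

open +-*-Solver using (solve; _:=_; _:+_; _:-_; :-_; _:*_)

private variable
  p q r ε : ℚ

fromℤ : ℤ → ℚ
fromℤ i = i ℚ./ 1

∥_∥ℚ : ℚ → ℚ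
∥ p ∥ℚ = ℚ.∣ p ℚ.- fromℤ (round p) ∣

1-coprime : ∀ {n} → Coprime n 1
1-coprime = sym (1-coprimeTo _)

fromℤ≡ : ∀ i → fromℤ i ≡ mkℚ i 0 1-coprime
fromℤ≡ i = ℚ.↥p/↧p≡p (mkℚ i 0 1-coprime)

fromℤ-mono : ∀ {i j} → i ℤ.≤ j → fromℤ i ℚ.≤ fromℤ j
fromℤ-mono {i} {j} i≤j rewrite fromℤ≡ i | fromℤ≡ j = *≤* (ℤ.*-monoʳ-≤-nonNeg 1ℤ i≤j)

fromℤ-suc : ∀ i → fromℤ (ℤ.suc i) ≡ 1ℚ ℚ.+ fromℤ i
fromℤ-suc i rewrite fromℤ≡ i = cong fromℤ (cong (λ j → 1ℤ ℤ.+ j) (≡.sym (ℤ.*-identityʳ i)))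

fromℤ-neg : ∀ i → fromℤ (ℤ.- i) ≡ ℚ.- fromℤ i
fromℤ-neg (+ ℕ.zero)   = refl
fromℤ-neg ℤ.+[1+ n ]   = refl
fromℤ-neg ℤ.-[1+ n ]   = ≡.sym (neg-neg (fromℤ (+ ℕ.suc n)))
  where
  neg-neg : ∀ p → ℚ.- (ℚ.- p) ≡ p
  neg-neg = solve 1 (λ p → :- (:- p) := p) refl

floor≤ : ∀ p → fromℤ (floor p) ℚ.≤ p
floor≤ p@(mkℚ n d-1 _) rewrite fromℤ≡ (floor p) =
  *≤* (subst (floor p ℤ.* ℚ.↧ p ℤ.≤_) (≡.sym (ℤ.*-identityʳ n)) (ℤ.[n/d]*d≤n n (ℚ.↧ p)))

<1+floor : ∀ p → p ℚ.< 1ℚ ℚ.+ fromℤ (floor p)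
<1+floor p@(mkℚ n d-1 _) rewrite ≡.sym (fromℤ-suc (floor p)) | fromℤ≡ (ℤ.suc (floor p)) =
  *<* (subst₂ ℤ._<_ (≡.sym (ℤ.*-identityʳ n))
         (cong (λ i → ℤ.suc i ℤ.* ℚ.↧ p) (≡.sym (ℤ.div-pos-is-/ℕ n (ℕ.suc d-1))))
         (ℤ.n<s[n/ℕd]*d n (ℕ.suc d-1)))

ceiling≡ : ∀ p → ceiling p ≡ ℤ.- floor (ℚ.- p)
ceiling≡ (mkℚ _ _ _) = refl

∣-∣-≤ : p ℚ.≤ q → ℚ.- p ℚ.≤ q → ℚ.∣ p ∣ ℚ.≤ q
∣-∣-≤ {p} p≤q -p≤q with ℚ.∣p∣≡p∨∣p∣≡-p p
... | inj₁ eq = subst (ℚ._≤ _) (≡.sym eq) p≤q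
... | inj₂ eq = subst (ℚ._≤ _) (≡.sym eq) -p≤q

p≤∣p∣ : ∀ p → p ℚ.≤ ℚ.∣ p ∣
p≤∣p∣ p with ℚ.≤-total 0ℚ p
... | inj₁ 0≤p = ℚ.≤-reflexive (≡.sym (ℚ.0≤p⇒∣p∣≡p 0≤p))
... | inj₂ p≤0 = ℚ.≤-trans p≤0 (ℚ.0≤∣p∣ p)

∣p-q∣≡∣q-p∣ : ∀ p q → ℚ.∣ p ℚ.- q ∣ ≡ ℚ.∣ q ℚ.- p ∣
∣p-q∣≡∣q-p∣ p q = ≡.trans (cong ℚ.∣_∣ (solve 2 (λ p q → p :- q := :- (q :- p)) refl p q)) (ℚ.∣-p∣≡∣p∣ (q ℚ.- p))

triangle : ∀ p q r → ℚ.∣ p ℚ.- r ∣ ℚ.≤ ℚ.∣ p ℚ.- q ∣ ℚ.+ ℚ.∣ q ℚ.- r ∣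
triangle p q r = subst (λ z → ℚ.∣ z ∣ ℚ.≤ ℚ.∣ p ℚ.- q ∣ ℚ.+ ℚ.∣ q ℚ.- r ∣)
  (solve 3 (λ p q r → (p :- q) :+ (q :- r) := p :- r) refl p q r)
  (ℚ.∣p+q∣≤∣p∣+∣q∣ (p ℚ.- q) (q ℚ.- r))

∥p∥≤½ : ∀ p → ∥ p ∥ℚ ℚ.≤ ½
∥p∥≤½ p with p ℚ.≤ᵇ 0ℚ
... | false = ∣-∣-≤ upper lower
  where
  f = fromℤ (floor (p ℚ.+ ½))
  open ≤-Reasoning
  upper : p ℚ.- f ℚ.≤ ½
  upper = begin
    p ℚ.- f                        ≡⟨ solve 3 (λ p h f → p :- f := (p :+ h) :+ (:- h :- f)) refl p ½ f ⟩
    (p ℚ.+ ½) ℚ.+ (ℚ.- ½ ℚ.- f)    ≤⟨ ℚ.+-monoˡ-≤ _ (ℚ.<⇒≤ (<1+floor (p ℚ.+ ½))) ⟩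
    (1ℚ ℚ.+ f) ℚ.+ (ℚ.- ½ ℚ.- f)   ≡⟨ solve 3 (λ o h f → (o :+ f) :+ (:- h :- f) := o :- h) refl 1ℚ ½ f ⟩
    ½                              ∎
  lower : ℚ.- (p ℚ.- f) ℚ.≤ ½
  lower = begin
    ℚ.- (p ℚ.- f)                  ≡⟨ solve 2 (λ p f → :- (p :- f) := f :+ :- p) refl p f ⟩
    f ℚ.+ ℚ.- p                    ≤⟨ ℚ.+-monoˡ-≤ _ (floor≤ (p ℚ.+ ½)) ⟩
    (p ℚ.+ ½) ℚ.+ ℚ.- p            ≡⟨ solve 2 (λ p h → (p :+ h) :+ :- p := h) refl p ½ ⟩
    ½                              ∎
... | true = ∣-∣-≤ upper lower
  where
  f = fromℤ (floor (ℚ.- (p ℚ.- ½)))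
  c≡-f : fromℤ (ceiling (p ℚ.- ½)) ≡ ℚ.- f
  c≡-f = ≡.trans (cong fromℤ (ceiling≡ (p ℚ.- ½))) (fromℤ-neg (floor (ℚ.- (p ℚ.- ½))))
  open ≤-Reasoning
  upper : p ℚ.- fromℤ (ceiling (p ℚ.- ½)) ℚ.≤ ½
  upper rewrite c≡-f = begin
    p ℚ.- ℚ.- f                    ≡⟨ solve 2 (λ p f → p :- :- f := f :+ p) refl p f ⟩
    f ℚ.+ p                        ≤⟨ ℚ.+-monoˡ-≤ p (floor≤ (ℚ.- (p ℚ.- ½))) ⟩
    ℚ.- (p ℚ.- ½) ℚ.+ p            ≡⟨ solve 2 (λ p h → :- (p :- h) :+ p := h) refl p ½ ⟩
    ½                              ∎
  lower : ℚ.- (p ℚ.- fromℤ (ceiling (p ℚ.- ½))) ℚ.≤ ½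
  lower rewrite c≡-f = begin
    ℚ.- (p ℚ.- ℚ.- f)                      ≡⟨ solve 3 (λ p h f → :- (p :- :- f) := :- (p :- h) :+ (:- h :- f)) refl p ½ f ⟩
    ℚ.- (p ℚ.- ½) ℚ.+ (ℚ.- ½ ℚ.- f)        ≤⟨ ℚ.+-monoˡ-≤ _ (ℚ.<⇒≤ (<1+floor (ℚ.- (p ℚ.- ½)))) ⟩
    (1ℚ ℚ.+ f) ℚ.+ (ℚ.- ½ ℚ.- f)           ≡⟨ solve 3 (λ o h f → (o :+ f) :+ (:- h :- f) := o :- h) refl 1ℚ ½ f ⟩
    ½                                      ∎

1≤∣fromℤ-fromℤ∣ : ∀ {i j} → i ℤ.< j → 1ℚ ℚ.≤ ℚ.∣ fromℤ j ℚ.- fromℤ i ∣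
1≤∣fromℤ-fromℤ∣ {i} {j} i<j = begin
  1ℚ                             ≡⟨ solve 2 (λ o i → o := (o :+ i) :- i) refl 1ℚ (fromℤ i) ⟩
  (1ℚ ℚ.+ fromℤ i) ℚ.- fromℤ i   ≡⟨ cong (ℚ._- fromℤ i) (fromℤ-suc i) ⟨
  fromℤ (ℤ.suc i) ℚ.- fromℤ i    ≤⟨ ℚ.+-monoˡ-≤ _ (fromℤ-mono (ℤ.i<j⇒suc[i]≤j i<j)) ⟩
  fromℤ j ℚ.- fromℤ i            ≤⟨ p≤∣p∣ _ ⟩
  ℚ.∣ fromℤ j ℚ.- fromℤ i ∣      ∎
  where open ≤-Reasoning

∥p∥≤∣p-i∣ : ∀ p i → ∥ p ∥ℚ ℚ.≤ ℚ.∣ p ℚ.- fromℤ i ∣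
∥p∥≤∣p-i∣ p i = byCases (ℤ.<-cmp i (round p))
  where
  far : 1ℚ ℚ.≤ ℚ.∣ fromℤ (round p) ℚ.- fromℤ i ∣ → ∥ p ∥ℚ ℚ.≤ ℚ.∣ p ℚ.- fromℤ i ∣
  far 1≤ = begin
    ∥ p ∥ℚ                                                        ≤⟨ ∥p∥≤½ p ⟩
    1ℚ ℚ.- ½                                                      ≤⟨ ℚ.+-mono-≤ 1≤ (ℚ.neg-antimono-≤ (∥p∥≤½ p)) ⟩
    ℚ.∣ fromℤ (round p) ℚ.- fromℤ i ∣ ℚ.- ∥ p ∥ℚ                  ≤⟨ ℚ.+-monoˡ-≤ _ (triangle (fromℤ (round p)) p (fromℤ i)) ⟩
    (ℚ.∣ fromℤ (round p) ℚ.- p ∣ ℚ.+ ℚ.∣ p ℚ.- fromℤ i ∣) ℚ.- ∥ p ∥ℚ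
      ≡⟨ cong (λ z → (z ℚ.+ ℚ.∣ p ℚ.- fromℤ i ∣) ℚ.- ∥ p ∥ℚ) (∣p-q∣≡∣q-p∣ (fromℤ (round p)) p) ⟩
    (∥ p ∥ℚ ℚ.+ ℚ.∣ p ℚ.- fromℤ i ∣) ℚ.- ∥ p ∥ℚ                   ≡⟨ solve 2 (λ a b → (a :+ b) :- a := b) refl ∥ p ∥ℚ _ ⟩
    ℚ.∣ p ℚ.- fromℤ i ∣                                           ∎
    where open ≤-Reasoning
  byCases : Tri (i ℤ.< round p) (i ≡ round p) (round p ℤ.< i) → ∥ p ∥ℚ ℚ.≤ ℚ.∣ p ℚ.- fromℤ i ∣
  byCases (tri< i<r _ _) = far (1≤∣fromℤ-fromℤ∣ i<r)
  byCases (tri≈ _ refl _) = ℚ.≤-refl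
  byCases (tri> _ _ r<i) = far (subst (1ℚ ℚ.≤_) (∣p-q∣≡∣q-p∣ (fromℤ i) _) (1≤∣fromℤ-fromℤ∣ r<i))

Nonexpansive₁ : (ℚ → ℚ) → Set
Nonexpansive₁ f = ∀ p q → ℚ.∣ f p ℚ.- f q ∣ ℚ.≤ ℚ.∣ p ℚ.- q ∣

Nonexpansive₂ : (ℚ → ℚ → ℚ) → Set
Nonexpansive₂ f = ∀ p q p′ q′ → ℚ.∣ f p q ℚ.- f p′ q′ ∣ ℚ.≤ ℚ.∣ p ℚ.- p′ ∣ ℚ.+ ℚ.∣ q ℚ.- q′ ∣

p≤q+∣p-q∣ : ∀ p q → p ℚ.≤ q ℚ.+ ℚ.∣ p ℚ.- q ∣
p≤q+∣p-q∣ p q = begin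
  p                          ≡⟨ solve 2 (λ p q → p := q :+ (p :- q)) refl p q ⟩
  q ℚ.+ (p ℚ.- q)            ≤⟨ ℚ.+-monoʳ-≤ q (p≤∣p∣ _) ⟩
  q ℚ.+ ℚ.∣ p ℚ.- q ∣        ∎
  where open ≤-Reasoning

∣p-q∣-≤ : p ℚ.≤ q ℚ.+ r → q ℚ.≤ p ℚ.+ r → ℚ.∣ p ℚ.- q ∣ ℚ.≤ r
∣p-q∣-≤ {p} {q} {r} p≤q+r q≤p+r = ∣-∣-≤
  (begin
    p ℚ.- q            ≤⟨ ℚ.+-monoˡ-≤ _ p≤q+r ⟩
    (q ℚ.+ r) ℚ.- q    ≡⟨ solve 2 (λ q r → (q :+ r) :- q := r) refl q r ⟩
    r                  ∎)
  (begin
    ℚ.- (p ℚ.- q)      ≡⟨ solve 2 (λ p q → :- (p :- q) := q :- p) refl p q ⟩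
    q ℚ.- p            ≤⟨ ℚ.+-monoˡ-≤ _ q≤p+r ⟩
    (p ℚ.+ r) ℚ.- p    ≡⟨ solve 2 (λ p r → (p :+ r) :- p := r) refl p r ⟩
    r                  ∎)
  where open ≤-Reasoning

lipschitz₁ : ∀ f → (∀ p q → f p ℚ.≤ f q ℚ.+ ℚ.∣ p ℚ.- q ∣) → Nonexpansive₁ f
lipschitz₁ f f≤ p q = ∣p-q∣-≤ (f≤ p q) (subst (λ z → f q ℚ.≤ f p ℚ.+ z) (∣p-q∣≡∣q-p∣ q p) (f≤ q p))

lipschitz₂ : ∀ f → (∀ p q p′ q′ → f p q ℚ.≤ f p′ q′ ℚ.+ (ℚ.∣ p ℚ.- p′ ∣ ℚ.+ ℚ.∣ q ℚ.- q′ ∣)) → Nonexpansive₂ f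
lipschitz₂ f f≤ p q p′ q′ = ∣p-q∣-≤ (f≤ p q p′ q′)
  (subst (λ z → f p′ q′ ℚ.≤ f p q ℚ.+ z) (cong₂ ℚ._+_ (∣p-q∣≡∣q-p∣ p′ p) (∣p-q∣≡∣q-p∣ q′ q)) (f≤ p′ q′ p q))

∣-∣-nonexpansive : Nonexpansive₁ ℚ.∣_∣
∣-∣-nonexpansive = lipschitz₁ ℚ.∣_∣ λ p q → begin
  ℚ.∣ p ∣                        ≡⟨ cong ℚ.∣_∣ (solve 2 (λ p q → p := q :+ (p :- q)) refl p q) ⟩
  ℚ.∣ q ℚ.+ (p ℚ.- q) ∣          ≤⟨ ℚ.∣p+q∣≤∣p∣+∣q∣ q (p ℚ.- q) ⟩
  ℚ.∣ q ∣ ℚ.+ ℚ.∣ p ℚ.- q ∣      ∎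
  where open ≤-Reasoning

∥-∥-nonexpansive : Nonexpansive₁ ∥_∥ℚ
∥-∥-nonexpansive = lipschitz₁ ∥_∥ℚ λ p q → begin
  ∥ p ∥ℚ                               ≤⟨ ∥p∥≤∣p-i∣ p (round q) ⟩
  ℚ.∣ p ℚ.- fromℤ (round q) ∣          ≤⟨ triangle p q (fromℤ (round q)) ⟩
  ℚ.∣ p ℚ.- q ∣ ℚ.+ ∥ q ∥ℚ             ≡⟨ ℚ.+-comm ℚ.∣ p ℚ.- q ∣ ∥ q ∥ℚ ⟩
  ∥ q ∥ℚ ℚ.+ ℚ.∣ p ℚ.- q ∣             ∎
  where open ≤-Reasoning

-‿nonexpansive : Nonexpansive₂ ℚ._-_
-‿nonexpansive p q p′ q′ = begin
  ℚ.∣ (p ℚ.- q) ℚ.- (p′ ℚ.- q′) ∣        ≡⟨ cong ℚ.∣_∣ (solve 4 (λ p q p′ q′ → (p :- q) :- (p′ :- q′) := (p :- p′) :- (q :- q′)) refl p q p′ q′) ⟩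
  ℚ.∣ (p ℚ.- p′) ℚ.- (q ℚ.- q′) ∣        ≤⟨ ℚ.∣p-q∣≤∣p∣+∣q∣ (p ℚ.- p′) (q ℚ.- q′) ⟩
  ℚ.∣ p ℚ.- p′ ∣ ℚ.+ ℚ.∣ q ℚ.- q′ ∣      ∎
  where open ≤-Reasoning

⊓-nonexpansive : Nonexpansive₂ ℚ._⊓_
⊓-nonexpansive = lipschitz₂ ℚ._⊓_ bound
  where
  open ≤-Reasoning
  bound : ∀ p q p′ q′ → p ℚ.⊓ q ℚ.≤ (p′ ℚ.⊓ q′) ℚ.+ (ℚ.∣ p ℚ.- p′ ∣ ℚ.+ ℚ.∣ q ℚ.- q′ ∣)
  bound p q p′ q′ with ℚ.⊓-sel p′ q′
  ... | inj₁ eq rewrite eq = begin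
    p ℚ.⊓ q                                        ≤⟨ ℚ.p⊓q≤p p q ⟩
    p                                              ≤⟨ p≤q+∣p-q∣ p p′ ⟩
    p′ ℚ.+ ℚ.∣ p ℚ.- p′ ∣                          ≡⟨ cong (λ z → p′ ℚ.+ z) (ℚ.+-identityʳ _) ⟨
    p′ ℚ.+ (ℚ.∣ p ℚ.- p′ ∣ ℚ.+ 0ℚ)                 ≤⟨ ℚ.+-monoʳ-≤ p′ (ℚ.+-monoʳ-≤ ℚ.∣ p ℚ.- p′ ∣ (ℚ.0≤∣p∣ (q ℚ.- q′))) ⟩
    p′ ℚ.+ (ℚ.∣ p ℚ.- p′ ∣ ℚ.+ ℚ.∣ q ℚ.- q′ ∣)     ∎
  ... | inj₂ eq rewrite eq = begin
    p ℚ.⊓ q                                        ≤⟨ ℚ.p⊓q≤q p q ⟩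
    q                                              ≤⟨ p≤q+∣p-q∣ q q′ ⟩
    q′ ℚ.+ ℚ.∣ q ℚ.- q′ ∣                          ≡⟨ cong (λ z → q′ ℚ.+ z) (ℚ.+-identityˡ _) ⟨
    q′ ℚ.+ (0ℚ ℚ.+ ℚ.∣ q ℚ.- q′ ∣)                 ≤⟨ ℚ.+-monoʳ-≤ q′ (ℚ.+-monoˡ-≤ ℚ.∣ q ℚ.- q′ ∣ (ℚ.0≤∣p∣ (p ℚ.- p′))) ⟩
    q′ ℚ.+ (ℚ.∣ p ℚ.- p′ ∣ ℚ.+ ℚ.∣ q ℚ.- q′ ∣)     ∎

Cauchy : (ℕ → ℚ) → Set
Cauchy x = ∀ {ε} → 0ℚ ℚ.< ε → ∃ λ N → ∀ {m n} → N ℕ.≤ m → N ℕ.≤ n → ℚ.∣ x m ℚ.- x n ∣ ℚ.< ε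

record ℝ : Set where
  constructor mkℝ
  field
    seq    : ℕ → ℚ
    cauchy : Cauchy seq

open ℝ public

infix 4 _≃_ _≤_

_≃_ : ℝ → ℝ → Set
x ≃ y = ∀ {ε} → 0ℚ ℚ.< ε → ∃ λ N → ∀ {n} → N ℕ.≤ n → ℚ.∣ seq x n ℚ.- seq y n ∣ ℚ.< ε

_≤_ : ℝ → ℝ → Set
x ≤ y = ∀ {ε} → 0ℚ ℚ.< ε → ∃ λ N → ∀ {n} → N ℕ.≤ n → seq x n ℚ.< seq y n ℚ.+ ε

fromℚ : ℚ → ℝ
fromℚ p = mkℝ (λ _ → p) λ {ε} 0<ε → 0 , λ _ _ → subst (λ z → ℚ.∣ z ∣ ℚ.< ε) (≡.sym (ℚ.+-inverseʳ p)) 0<ε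

0<½* : 0ℚ ℚ.< ε → 0ℚ ℚ.< ½ ℚ.* ε
0<½* 0<ε = ℚ.*-monoʳ-<-pos ½ 0<ε

½+½ : ∀ ε → ½ ℚ.* ε ℚ.+ ½ ℚ.* ε ≡ ε
½+½ ε = ≡.trans (≡.sym (ℚ.*-distribʳ-+ ε ½ ½)) (ℚ.*-identityˡ ε)

lift₁ : ∀ f → Nonexpansive₁ f → ℝ → ℝ
lift₁ f lip x = mkℝ (λ n → f (seq x n)) λ 0<ε →
  let N , close = cauchy x 0<ε in N , λ N≤m N≤n → ℚ.≤-<-trans (lip _ _) (close N≤m N≤n)

lift₂ : ∀ f → Nonexpansive₂ f → ℝ → ℝ → ℝ
lift₂ f lip x y = mkℝ (λ n → f (seq x n) (seq y n)) λ {ε} 0<ε →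
  let M , closeˣ = cauchy x (0<½* 0<ε)
      N , closeʸ = cauchy y (0<½* 0<ε)
  in M ℕ.⊔ N , λ ≤m ≤n → subst (_ ℚ.<_) (½+½ ε) (ℚ.≤-<-trans (lip _ _ _ _) (ℚ.+-mono-<
       (closeˣ (ℕ.m⊔n≤o⇒m≤o M N ≤m) (ℕ.m⊔n≤o⇒m≤o M N ≤n))
       (closeʸ (ℕ.m⊔n≤o⇒n≤o M N ≤m) (ℕ.m⊔n≤o⇒n≤o M N ≤n))))

infixl 6 _-_
infixl 7 _⊓_ _·_

∣_∣ : ℝ → ℝ
∣_∣ = lift₁ ℚ.∣_∣ ∣-∣-nonexpansive

_-_ : ℝ → ℝ → ℝ
_-_ = lift₂ ℚ._-_ -‿nonexpansive

_⊓_ : ℝ → ℝ → ℝ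
_⊓_ = lift₂ ℚ._⊓_ ⊓-nonexpansive

-- Extended from ℚ by continuity, since the integer nearest to a real number is
-- not computable; ∥x∥≤∣x-i∣ and ∥x∥-greatest show that ∥ x ∥ is the infimum of
-- ∣ x - i ∣ over the integers i.
∥_∥ : ℝ → ℝ
∥_∥ = lift₁ ∥_∥ℚ ∥-∥-nonexpansive

·-cauchy : ∀ x v → Cauchy (λ n → seq x n ℚ.* fromℤ (+ v))
·-cauchy x v {ε} 0<ε = N , λ {m} {n} N≤m N≤n → begin-strict
    ℚ.∣ seq x m ℚ.* fromℤ (+ v) ℚ.- seq x n ℚ.* fromℤ (+ v) ∣
      ≡⟨ cong ℚ.∣_∣ (solve 3 (λ a b k → a :* k :- b :* k := (a :- b) :* k) refl (seq x m) (seq x n) (fromℤ (+ v))) ⟩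
    ℚ.∣ (seq x m ℚ.- seq x n) ℚ.* fromℤ (+ v) ∣
      ≡⟨ ℚ.∣p*q∣≡∣p∣*∣q∣ (seq x m ℚ.- seq x n) (fromℤ (+ v)) ⟩
    d m n ℚ.* ℚ.∣ fromℤ (+ v) ∣
      ≡⟨ cong (d m n ℚ.*_) (ℚ.0≤p⇒∣p∣≡p (fromℤ-mono {+ 0} {+ v} (ℤ.+≤+ ℕ.z≤n))) ⟩
    d m n ℚ.* fromℤ (+ v)
      ≤⟨ ℚ.*-monoˡ-≤-nonNeg (d m n) {{ℚ.∣-∣-nonNeg (seq x m ℚ.- seq x n)}} (fromℤ-mono (ℤ.+≤+ (ℕ.n≤1+n v))) ⟩
    d m n ℚ.* fromℤ (+ ℕ.suc v)
      ≡⟨ cong (d m n ℚ.*_) (fromℤ≡ (+ ℕ.suc v)) ⟩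
    d m n ℚ.* c
      <⟨ ℚ.*-monoˡ-<-pos c (close N≤m N≤n) ⟩
    (ε ℚ.* ℚ.1/ c) ℚ.* c
      ≡⟨ ℚ.*-assoc ε (ℚ.1/ c) c ⟩
    ε ℚ.* (ℚ.1/ c ℚ.* c)
      ≡⟨ cong (ε ℚ.*_) (ℚ.*-inverseˡ c) ⟩
    ε ℚ.* 1ℚ
      ≡⟨ ℚ.*-identityʳ ε ⟩
    ε ∎
  where
  open ≤-Reasoning
  d : ℕ → ℕ → ℚ
  d m n = ℚ.∣ seq x m ℚ.- seq x n ∣
  c : ℚ
  c = mkℚ (+ ℕ.suc v) 0 1-coprime
  0<ε/c : 0ℚ ℚ.< ε ℚ.* ℚ.1/ c
  0<ε/c = subst (ℚ._< ε ℚ.* ℚ.1/ c) (ℚ.*-zeroˡ (ℚ.1/ c)) (ℚ.*-monoˡ-<-pos (ℚ.1/ c) 0<ε)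
  N     = proj₁ (cauchy x 0<ε/c)
  close = proj₂ (cauchy x 0<ε/c)

_·_ : ℝ → ℕ → ℝ
x · v = mkℝ (λ n → seq x n ℚ.* fromℤ (+ v)) (·-cauchy x v)

≤-pointwise : ∀ {x y} → (∀ n → seq x n ℚ.≤ seq y n) → x ≤ y
≤-pointwise {x} {y} x≤y {ε} 0<ε = 0 , λ {n} _ →
  ℚ.≤-<-trans (x≤y n) (subst (ℚ._< seq y n ℚ.+ ε) (ℚ.+-identityʳ _) (ℚ.+-monoʳ-< (seq y n) 0<ε))

∥x∥≤∣x-i∣ : ∀ x i → ∥ x ∥ ≤ ∣ x - fromℚ (fromℤ i) ∣
∥x∥≤∣x-i∣ x i = ≤-pointwise {∥ x ∥} {∣ x - fromℚ (fromℤ i) ∣} λ n → ∥p∥≤∣p-i∣ (seq x n) i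

∥x∥-greatest : ∀ x y → (∀ i → y ≤ ∣ x - fromℚ (fromℤ i) ∣) → y ≤ ∥ x ∥
∥x∥-greatest x y y≤ {ε} 0<ε =
  let 0<δ = 0<½* (0<½* 0<ε)
      M , close = cauchy x 0<δ
      i = round (seq x M)
      N , below = y≤ i (0<½* 0<ε)
  in M ℕ.⊔ N , λ {n} ≤n →
  let M≤n = ℕ.m⊔n≤o⇒m≤o M N ≤n
      xₙ = seq x n
      xₘ = seq x M
      δ = ½ ℚ.* (½ ℚ.* ε)
      open ≤-Reasoning
  in begin-strict
    seq y n                                            <⟨ below (ℕ.m⊔n≤o⇒n≤o M N ≤n) ⟩
    ℚ.∣ xₙ ℚ.- fromℤ i ∣ ℚ.+ ½ ℚ.* ε                   ≤⟨ ℚ.+-monoˡ-≤ _ (triangle xₙ xₘ (fromℤ i)) ⟩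
    (ℚ.∣ xₙ ℚ.- xₘ ∣ ℚ.+ ∥ xₘ ∥ℚ) ℚ.+ ½ ℚ.* ε          ≤⟨ ℚ.+-monoˡ-≤ _ (ℚ.+-mono-≤ (ℚ.<⇒≤ (close M≤n ℕ.≤-refl)) (p≤q+∣p-q∣ ∥ xₘ ∥ℚ ∥ xₙ ∥ℚ)) ⟩
    (δ ℚ.+ (∥ xₙ ∥ℚ ℚ.+ ℚ.∣ ∥ xₘ ∥ℚ ℚ.- ∥ xₙ ∥ℚ ∣)) ℚ.+ ½ ℚ.* ε
      ≤⟨ ℚ.+-monoˡ-≤ _ (ℚ.+-monoʳ-≤ δ (ℚ.+-monoʳ-≤ ∥ xₙ ∥ℚ (ℚ.≤-trans (∥-∥-nonexpansive xₘ xₙ) (ℚ.<⇒≤ (close ℕ.≤-refl M≤n))))) ⟩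
    (δ ℚ.+ (∥ xₙ ∥ℚ ℚ.+ δ)) ℚ.+ ½ ℚ.* ε                ≡⟨ solve 3 (λ d a h → (d :+ (a :+ d)) :+ h := a :+ ((d :+ d) :+ h)) refl δ ∥ xₙ ∥ℚ (½ ℚ.* ε) ⟩
    ∥ xₙ ∥ℚ ℚ.+ ((δ ℚ.+ δ) ℚ.+ ½ ℚ.* ε)                ≡⟨ cong (λ z → ∥ xₙ ∥ℚ ℚ.+ (z ℚ.+ ½ ℚ.* ε)) (½+½ (½ ℚ.* ε)) ⟩
    ∥ xₙ ∥ℚ ℚ.+ (½ ℚ.* ε ℚ.+ ½ ℚ.* ε)                  ≡⟨ cong (λ z → ∥ xₙ ∥ℚ ℚ.+ z) (½+½ ε) ⟩
    ∥ xₙ ∥ℚ ℚ.+ ε                                      ∎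

IsMaximum : (ℝ → ℝ) → ℝ → Set
IsMaximum f μ = (∃ λ t → f t ≃ μ) × (∀ t → f t ≤ μ)

loneliness : List⁺ ℕ → ℝ → ℝ
loneliness vs t = foldr₁ _⊓_ (map (λ v → ∥ t · v ∥) vs)

-- A relation rather than a function: attainment of the maximum is part of the
-- assertion, and IsMaximum-unique shows that it determines μ.
infix 4 ML_≃_

ML_≃_ : List⁺ ℕ → ℝ → Set
ML vs ≃ μ = IsMaximum (loneliness vs) μ

≤-antisym : ∀ {x y} → x ≤ y → y ≤ x → x ≃ y
≤-antisym {x} {y} x≤y y≤x {ε} 0<ε =
  let M , x<y+δ = x≤y (0<½* 0<ε)
      N , y<x+δ = y≤x (0<½* 0<ε)
  in M ℕ.⊔ N , λ ≤n → ℚ.≤-<-trans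
       (∣p-q∣-≤ (ℚ.<⇒≤ (x<y+δ (ℕ.m⊔n≤o⇒m≤o M N ≤n))) (ℚ.<⇒≤ (y<x+δ (ℕ.m⊔n≤o⇒n≤o M N ≤n))))
       (subst₂ ℚ._<_ (ℚ.+-identityʳ (½ ℚ.* ε)) (½+½ ε) (ℚ.+-monoʳ-< (½ ℚ.* ε) (0<½* 0<ε)))

≤-respˡ-≃ : ∀ {x y z} → x ≃ y → x ≤ z → y ≤ z
≤-respˡ-≃ {x} {y} {z} x≃y x≤z {ε} 0<ε =
  let M , near = x≃y (0<½* 0<ε)
      N , x<z+δ = x≤z (0<½* 0<ε)
      open ≤-Reasoning
  in M ℕ.⊔ N , λ {n} ≤n → begin-strict
    seq y n                                    ≤⟨ p≤q+∣p-q∣ (seq y n) (seq x n) ⟩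
    seq x n ℚ.+ ℚ.∣ seq y n ℚ.- seq x n ∣      ≡⟨ cong (seq x n ℚ.+_) (∣p-q∣≡∣q-p∣ (seq y n) (seq x n)) ⟩
    seq x n ℚ.+ ℚ.∣ seq x n ℚ.- seq y n ∣      <⟨ ℚ.+-mono-< (x<z+δ (ℕ.m⊔n≤o⇒n≤o M N ≤n)) (near (ℕ.m⊔n≤o⇒m≤o M N ≤n)) ⟩
    (seq z n ℚ.+ ½ ℚ.* ε) ℚ.+ ½ ℚ.* ε          ≡⟨ ℚ.+-assoc (seq z n) (½ ℚ.* ε) (½ ℚ.* ε) ⟩
    seq z n ℚ.+ (½ ℚ.* ε ℚ.+ ½ ℚ.* ε)          ≡⟨ cong (seq z n ℚ.+_) (½+½ ε) ⟩
    seq z n ℚ.+ ε                              ∎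

IsMaximum-unique : ∀ f {μ ν} → IsMaximum f μ → IsMaximum f ν → μ ≃ ν
IsMaximum-unique f {μ} {ν} ((t , ft≃μ) , f≤μ) ((u , fu≃ν) , f≤ν) =
  ≤-antisym {μ} {ν} (≤-respˡ-≃ {f t} {μ} {ν} ft≃μ (f≤ν t)) (≤-respˡ-≃ {f u} {ν} {μ} fu≃ν (f≤μ u))

{-# OPTIONS --safe #-}

-- The value s/(ns+1) is attained at t = s/(ns+1).  For the upper bound, let
-- a/b ≤ t ≤ c/d be Farey neighbours of order n-1, and put α = bt - a and
-- β = c - dt, so that dα + bβ = bc - ad = 1.  If α and β both exceed
-- μ = s/(ns+1), then (b+d)μ < 1 forces b + d = n, and dα + bβ = 1 then gives
-- ∣α-β∣ ≤ 1 - nμ = 1/(ns+1).  Hence nst = s(a+c) + s(α-β) lies within μ of an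
-- integer.
module Submission where

open import Data.Integer.Base using (+_)
open import Data.List.Base using (applyUpTo)
open import Data.List.NonEmpty.Base using (_∷ʳ_)
open import Data.Nat.Base using (ℕ; suc; _+_; _*_; _∸_; _≥_)
open import Data.Rational.Base using (_/_)
open import Defs using (ML_≃_; fromℚ)

open import Data.Integer.Base as ℤ using (ℤ)
import Data.Integer.Properties as ℤ
open import Data.List.Base using ([]; _∷_)
open import Data.List.Membership.Propositional using (_∈_)
open import Data.List.Membership.Propositional.Properties using (∈-++⁺ˡ; ∈-++⁺ʳ; ∈-applyUpTo⁺)
open import Data.List.NonEmpty.Base using (List⁺; _∷_; toList)
open import Data.List.Relation.Unary.All using (All; []; _∷_)
import Data.List.Relation.Unary.All.Properties as All
open import Data.List.Relation.Unary.Any using (here; there)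
open import Data.Nat.Base as ℕ using (z≤n; s≤s)
import Data.Nat.Properties as ℕ
open import Data.Product.Base using (∃; _×_; _,_)
open import Data.Rational.Base as ℚ using (ℚ; 0ℚ; 1ℚ; floor; round; toℚᵘ)
import Data.Rational.Properties as ℚ
open import Data.Rational.Solver using (module +-*-Solver)
open import Data.Rational.Unnormalised.Base as ℚᵘ using (mkℚᵘ; *≡*)
import Data.Rational.Unnormalised.Properties as ℚᵘ
open import Data.Sum.Base using (_⊎_; inj₁; inj₂)
open import Defs hiding (ML_≃_; fromℚ)
open import Relation.Binary.PropositionalEquality using (_≡_; refl; sym; trans; cong; cong₂; subst; subst₂; module ≡-Reasoning)
open import Relation.Nullary.Decidable.Core using (Dec; yes; no)

open +-*-Solver using (solve; _:=_; _:+_; _:-_; :-_; _:*_; con)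

-- Arithmetic of integers and quotients in the rationals.

⟨_⟩ : ℕ → ℚ
⟨ k ⟩ = fromℤ (+ k)

fromℤ-+ : ∀ i j → fromℤ (i ℤ.+ j) ≡ fromℤ i ℚ.+ fromℤ j
fromℤ-+ i j rewrite fromℤ≡ i | fromℤ≡ j =
  cong fromℤ (cong₂ ℤ._+_ (sym (ℤ.*-identityʳ i)) (sym (ℤ.*-identityʳ j)))

fromℤ-* : ∀ i j → fromℤ (i ℤ.* j) ≡ fromℤ i ℚ.* fromℤ j
fromℤ-* i j rewrite fromℤ≡ i | fromℤ≡ j = refl

⟨⟩-+ : ∀ j k → ⟨ j + k ⟩ ≡ ⟨ j ⟩ ℚ.+ ⟨ k ⟩
⟨⟩-+ j k = fromℤ-+ (+ j) (+ k)

⟨⟩-* : ∀ j k → ⟨ j * k ⟩ ≡ ⟨ j ⟩ ℚ.* ⟨ k ⟩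
⟨⟩-* j k = trans (cong fromℤ (ℤ.pos-* j k)) (fromℤ-* (+ j) (+ k))

⟨⟩-mono : ∀ {j k} → j ℕ.≤ k → ⟨ j ⟩ ℚ.≤ ⟨ k ⟩
⟨⟩-mono j≤k = fromℤ-mono (ℤ.+≤+ j≤k)

0≤⟨⟩ : ∀ k → 0ℚ ℚ.≤ ⟨ k ⟩
0≤⟨⟩ k = ⟨⟩-mono {0} {k} z≤n

-- `_/_` reduces to lowest terms, so the comparison is made by cross-multiplication among
-- unnormalised rationals. Every quotient then becomes a multiple of one reciprocal, which the ring
-- solver can treat as a variable.
/≡*1/ : ∀ i k .{{_ : ℕ.NonZero k}} → i / k ≡ fromℤ i ℚ.* (+ 1 / k)
/≡*1/ i k@(suc k-1) = ℚ.toℚᵘ-injective (begin-equality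
  toℚᵘ (i / k)                             ≃⟨ ℚ.toℚᵘ-fromℚᵘ (mkℚᵘ i k-1) ⟩
  mkℚᵘ i k-1                               ≃⟨ *≡* (cong₂ ℤ._*_ (sym (ℤ.*-identityʳ i)) (cong +_ (ℕ.*-identityˡ k))) ⟩
  mkℚᵘ i 0 ℚᵘ.* mkℚᵘ (+ 1) k-1             ≃⟨ ℚᵘ.*-cong (ℚ.toℚᵘ-fromℚᵘ (mkℚᵘ i 0)) (ℚ.toℚᵘ-fromℚᵘ (mkℚᵘ (+ 1) k-1)) ⟨
  toℚᵘ (fromℤ i) ℚᵘ.* toℚᵘ (+ 1 / k)       ≃⟨ ℚ.toℚᵘ-homo-* (fromℤ i) (+ 1 / k) ⟨
  toℚᵘ (fromℤ i ℚ.* (+ 1 / k))             ∎)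
  where open ℚᵘ.≤-Reasoning

k*1/k≡1 : ∀ k .{{_ : ℕ.NonZero k}} → ⟨ k ⟩ ℚ.* (+ 1 / k) ≡ 1ℚ
k*1/k≡1 k@(suc k-1) = trans (sym (/≡*1/ (+ k) k))
  (ℚ.fromℚᵘ-cong {mkℚᵘ (+ k) k-1} {mkℚᵘ (+ 1) 0} (*≡* (ℤ.*-comm (+ k) (+ 1))))

0≤1/k : ∀ k .{{_ : ℕ.NonZero k}} → 0ℚ ℚ.≤ + 1 / k
0≤1/k k = ℚ.nonNegative⁻¹ (+ 1 / k) {{ℚ.normalize-nonNeg 1 k}}

-- The pattern behind most inequalities below: the ring solver or a short calculation writes the
-- larger side as the smaller plus a remainder `r`, and `r` is a sum of products of nonnegative
-- factors supplied by `slack`.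
≤-slack : ∀ {p q r} → q ≡ p ℚ.+ r → 0ℚ ℚ.≤ r → p ℚ.≤ q
≤-slack {p} {r = r} refl 0≤r = subst (ℚ._≤ p ℚ.+ r) (ℚ.+-identityʳ p) (ℚ.+-monoʳ-≤ p 0≤r)

slack : ∀ {p q} → p ℚ.≤ q → 0ℚ ℚ.≤ q ℚ.- p
slack {p} {q} p≤q = subst (ℚ._≤ q ℚ.- p) (ℚ.+-inverseʳ p) (ℚ.+-monoˡ-≤ (ℚ.- p) p≤q)

0≤+ : ∀ {p q} → 0ℚ ℚ.≤ p → 0ℚ ℚ.≤ q → 0ℚ ℚ.≤ p ℚ.+ q
0≤+ = ℚ.+-mono-≤

0≤* : ∀ {p q} → 0ℚ ℚ.≤ p → 0ℚ ℚ.≤ q → 0ℚ ℚ.≤ p ℚ.* q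
0≤* {p} {q} 0≤p 0≤q = subst (ℚ._≤ p ℚ.* q) (ℚ.*-zeroˡ q) (ℚ.*-monoʳ-≤-nonNeg q {{ℚ.nonNegative 0≤q}} 0≤p)

-- Bounds for the distance to the nearest integer and for loneliness.

-- No integer lies strictly between `i` and `i + 1`, so `round p` is either at most `i` or at least
-- `i + 1`; one hypothesis settles each case.
≤∥p∥ : ∀ {p r} i → fromℤ i ℚ.+ r ℚ.≤ p → p ℚ.+ r ℚ.≤ fromℤ (ℤ.suc i) → r ℚ.≤ ∥ p ∥ℚ
≤∥p∥ {p} {r} i lo hi = byCases (round p ℤ.≤? i)
  where
  ρ = fromℤ (round p)
  byCases : Dec (round p ℤ.≤ i) → r ℚ.≤ ∥ p ∥ℚ
  byCases (yes ρ≤i) = ℚ.≤-trans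
    (≤-slack (solve 4 (λ p ρ i r → p :- ρ := r :+ ((p :- (i :+ r)) :+ (i :- ρ))) refl p ρ (fromℤ i) r)
      (0≤+ (slack lo) (slack (fromℤ-mono ρ≤i))))
    (p≤∣p∣ (p ℚ.- ρ))
  byCases (no ρ≰i) = subst (r ℚ.≤_) (∣p-q∣≡∣q-p∣ ρ p) (ℚ.≤-trans
    (≤-slack (solve 4 (λ p ρ j r → ρ :- p := r :+ ((j :- (p :+ r)) :+ (ρ :- j))) refl p ρ (fromℤ (ℤ.suc i)) r)
      (0≤+ (slack hi) (slack (fromℤ-mono (ℤ.i<j⇒suc[i]≤j (ℤ.≰⇒> ρ≰i))))))
    (p≤∣p∣ (ρ ℚ.- p)))

loneliness≤ : ∀ {v} vs t k → v ∈ toList vs → seq (loneliness vs t) k ℚ.≤ ∥ seq t k ℚ.* ⟨ v ⟩ ∥ℚ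
loneliness≤ (x ∷ [])     t k (here refl)  = ℚ.≤-refl
loneliness≤ (x ∷ y ∷ ys) t k (here refl)  = ℚ.p⊓q≤p _ _
loneliness≤ (x ∷ y ∷ ys) t k (there v∈vs) = ℚ.≤-trans (ℚ.p⊓q≤q ∥ seq t k ℚ.* ⟨ x ⟩ ∥ℚ _) (loneliness≤ (y ∷ ys) t k v∈vs)

≤loneliness : ∀ {r} vs t k → All (λ v → r ℚ.≤ ∥ seq t k ℚ.* ⟨ v ⟩ ∥ℚ) (toList vs) → r ℚ.≤ seq (loneliness vs t) k
≤loneliness (x ∷ [])     t k (r≤ ∷ [])  = r≤
≤loneliness (x ∷ y ∷ ys) t k (r≤ ∷ r≤s) = ℚ.⊓-glb r≤ (≤loneliness (y ∷ ys) t k r≤s)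

-- Farey neighbours of a rational.

-- The neighbours are a/b ≤ p ≤ c/d, with denominators cleared. `unimodular` is cb - ad = 1;
-- together with `m<b+d` it makes them adjacent among the fractions of denominator at most `m`.
record FareyNeighbours (p : ℚ) (m : ℕ) : Set where
  constructor farey
  field
    a c : ℤ
    b d : ℕ
    1≤b : 1 ℕ.≤ b
    1≤d : 1 ℕ.≤ d
    b≤m : b ℕ.≤ m
    d≤m : d ℕ.≤ m
    m<b+d : m ℕ.< b + d
    a≤pb : fromℤ a ℚ.≤ p ℚ.* ⟨ b ⟩
    pd≤c : p ℚ.* ⟨ d ⟩ ℚ.≤ fromℤ c
    unimodular : fromℤ c ℚ.* ⟨ b ⟩ ≡ 1ℚ ℚ.+ fromℤ a ℚ.* ⟨ d ⟩

-- Induction on the order, starting from consecutive integers around `p`. Passing from `m` to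
-- `m + 1`, the mediant (a+c)/(b+d) replaces one neighbour exactly when its denominator has become
-- admissible.
fareyNeighbours : ∀ p m → 1 ℕ.≤ m → FareyNeighbours p m
fareyNeighbours p 1 _ = record
  { a = floor p ; c = ℤ.suc (floor p) ; b = 1 ; d = 1
  ; 1≤b = ℕ.≤-refl ; 1≤d = ℕ.≤-refl ; b≤m = ℕ.≤-refl ; d≤m = ℕ.≤-refl ; m<b+d = ℕ.≤-refl
  ; a≤pb = subst (fromℤ (floor p) ℚ.≤_) (sym (ℚ.*-identityʳ p)) (floor≤ p)
  ; pd≤c = subst₂ ℚ._≤_ (sym (ℚ.*-identityʳ p)) (sym (fromℤ-suc (floor p))) (ℚ.<⇒≤ (<1+floor p))
  ; unimodular = trans (ℚ.*-identityʳ _) (trans (fromℤ-suc (floor p)) (cong (1ℚ ℚ.+_) (sym (ℚ.*-identityʳ (fromℤ (floor p))))))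
  }
fareyNeighbours p (suc m@(suc _)) _ = refine (fareyNeighbours p m (s≤s z≤n))
  where
  refine : FareyNeighbours p m → FareyNeighbours p (suc m)
  refine (farey a c b d 1≤b 1≤d b≤m d≤m m<b+d a≤pb pd≤c unimodular) =
    byCases (ℕ.<-≤-connex (suc m) (b + d)) (ℚ.≤-total (p ℚ.* ⟨ b + d ⟩) (fromℤ (a ℤ.+ c)))
    where
    byCases : suc m ℕ.< b + d ⊎ b + d ℕ.≤ suc m → p ℚ.* ⟨ b + d ⟩ ℚ.≤ fromℤ (a ℤ.+ c) ⊎ fromℤ (a ℤ.+ c) ℚ.≤ p ℚ.* ⟨ b + d ⟩ → FareyNeighbours p (suc m)
    byCases (inj₁ m+1<b+d) _ = farey a c b d 1≤b 1≤d (ℕ.m≤n⇒m≤1+n b≤m) (ℕ.m≤n⇒m≤1+n d≤m) m+1<b+d a≤pb pd≤c unimodular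
    -- The mediant takes over as the neighbour on its own side of `p`. The new denominator sum
    -- exceeds `b + d` by at least 1, which keeps it above the raised order.
    byCases (inj₂ b+d≤m+1) (inj₁ p≤mediant) =
      farey a (a ℤ.+ c) b (b + d) 1≤b (ℕ.≤-trans 1≤b (ℕ.m≤m+n b d)) (ℕ.m≤n⇒m≤1+n b≤m) b+d≤m+1
        (ℕ.+-mono-≤ 1≤b m<b+d) a≤pb p≤mediant
        (begin
          fromℤ (a ℤ.+ c) ℚ.* ⟨ b ⟩                                     ≡⟨ cong (ℚ._* ⟨ b ⟩) (fromℤ-+ a c) ⟩
          (fromℤ a ℚ.+ fromℤ c) ℚ.* ⟨ b ⟩                               ≡⟨ ℚ.*-distribʳ-+ ⟨ b ⟩ (fromℤ a) (fromℤ c) ⟩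
          fromℤ a ℚ.* ⟨ b ⟩ ℚ.+ fromℤ c ℚ.* ⟨ b ⟩                       ≡⟨ cong (fromℤ a ℚ.* ⟨ b ⟩ ℚ.+_) unimodular ⟩
          fromℤ a ℚ.* ⟨ b ⟩ ℚ.+ (1ℚ ℚ.+ fromℤ a ℚ.* ⟨ d ⟩)              ≡⟨ solve 4 (λ o a b d → a :* b :+ (o :+ a :* d) := o :+ a :* (b :+ d)) refl 1ℚ (fromℤ a) ⟨ b ⟩ ⟨ d ⟩ ⟩
          1ℚ ℚ.+ fromℤ a ℚ.* (⟨ b ⟩ ℚ.+ ⟨ d ⟩)                          ≡⟨ cong (λ z → 1ℚ ℚ.+ fromℤ a ℚ.* z) (⟨⟩-+ b d) ⟨
          1ℚ ℚ.+ fromℤ a ℚ.* ⟨ b + d ⟩                                  ∎)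
      where open ≡-Reasoning
    byCases (inj₂ b+d≤m+1) (inj₂ mediant≤p) =
      farey (a ℤ.+ c) c (b + d) d (ℕ.≤-trans 1≤b (ℕ.m≤m+n b d)) 1≤d b+d≤m+1 (ℕ.m≤n⇒m≤1+n d≤m)
        (subst (suc m ℕ.<_) (ℕ.+-comm d (b + d)) (ℕ.+-mono-≤ 1≤d m<b+d)) mediant≤p pd≤c
        (begin
          fromℤ c ℚ.* ⟨ b + d ⟩                                         ≡⟨ cong (fromℤ c ℚ.*_) (⟨⟩-+ b d) ⟩
          fromℤ c ℚ.* (⟨ b ⟩ ℚ.+ ⟨ d ⟩)                                 ≡⟨ ℚ.*-distribˡ-+ (fromℤ c) ⟨ b ⟩ ⟨ d ⟩ ⟩
          fromℤ c ℚ.* ⟨ b ⟩ ℚ.+ fromℤ c ℚ.* ⟨ d ⟩                       ≡⟨ cong (ℚ._+ fromℤ c ℚ.* ⟨ d ⟩) unimodular ⟩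
          (1ℚ ℚ.+ fromℤ a ℚ.* ⟨ d ⟩) ℚ.+ fromℤ c ℚ.* ⟨ d ⟩              ≡⟨ solve 4 (λ o a c d → (o :+ a :* d) :+ c :* d := o :+ (a :+ c) :* d) refl 1ℚ (fromℤ a) (fromℤ c) ⟨ d ⟩ ⟩
          1ℚ ℚ.+ (fromℤ a ℚ.+ fromℤ c) ℚ.* ⟨ d ⟩                        ≡⟨ cong (λ z → 1ℚ ℚ.+ z ℚ.* ⟨ d ⟩) (fromℤ-+ a c) ⟨
          1ℚ ℚ.+ fromℤ (a ℤ.+ c) ℚ.* ⟨ d ⟩                              ∎)
      where open ≡-Reasoning

-- The extremal value and the speeds, with n = m + 2.

module _ (m s : ℕ) (1≤s : 1 ℕ.≤ s) where

  private
    n N : ℕ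
    n = suc (suc m)
    N = 1 + n * s

    -- μ = s ν, where ν = 1/(ns+1) is also 1 - nμ.
    K S ν μ : ℚ
    K = ⟨ n ⟩
    S = ⟨ s ⟩
    ν = + 1 / N
    μ = S ℚ.* ν

    0≤ν : 0ℚ ℚ.≤ ν
    0≤ν = 0≤1/k N

    0≤μ : 0ℚ ℚ.≤ μ
    0≤μ = 0≤* (0≤⟨⟩ s) 0≤ν

    -- Clears the denominator ns+1 once; later identities treat `ν` as a variable subject to this
    -- relation.
    ν+Kμ≡1 : ν ℚ.+ K ℚ.* μ ≡ 1ℚ
    ν+Kμ≡1 = begin
      ν ℚ.+ K ℚ.* (S ℚ.* ν)     ≡⟨ solve 3 (λ ν K S → ν :+ K :* (S :* ν) := (con 1ℚ :+ K :* S) :* ν) refl ν K S ⟩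
      (1ℚ ℚ.+ K ℚ.* S) ℚ.* ν    ≡⟨ cong (λ z → (1ℚ ℚ.+ z) ℚ.* ν) (⟨⟩-* n s) ⟨
      (1ℚ ℚ.+ ⟨ n * s ⟩) ℚ.* ν  ≡⟨ cong (ℚ._* ν) (⟨⟩-+ 1 (n * s)) ⟨
      ⟨ N ⟩ ℚ.* ν               ≡⟨ k*1/k≡1 N ⟩
      1ℚ                        ∎
      where open ≡-Reasoning

  speeds : List⁺ ℕ
  speeds = applyUpTo suc (n ∸ 1) ∷ʳ n * s

  small∈speeds : ∀ {v} → 1 ℕ.≤ v → v ℕ.≤ suc m → v ∈ toList speeds
  small∈speeds {suc v} _ v<n = ∈-++⁺ˡ (∈-applyUpTo⁺ suc v<n)

  last∈speeds : n * s ∈ toList speeds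
  last∈speeds = ∈-++⁺ʳ (applyUpTo suc (n ∸ 1)) (here refl)

  -- Upper bound: some speed is always close to an integer.

  -- Three candidates suffice: the Farey denominators `b` and `d` of order n-1, which are themselves
  -- speeds, and `n * s` when both of these fail.
  ∃-close-speed : ∀ p → ∃ λ v → v ∈ toList speeds × ∥ p ℚ.* ⟨ v ⟩ ∥ℚ ℚ.≤ μ
  ∃-close-speed p = byCases (α ℚ.≤? μ) (β ℚ.≤? μ)
    where
    open FareyNeighbours (fareyNeighbours p (suc m) (s≤s z≤n))
    A = fromℤ a
    C = fromℤ c
    B = ⟨ b ⟩
    D = ⟨ d ⟩
    α = p ℚ.* B ℚ.- A
    β = C ℚ.- p ℚ.* D

    0≤B-1 : 0ℚ ℚ.≤ B ℚ.- 1ℚ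
    0≤B-1 = slack (⟨⟩-mono 1≤b)

    0≤D-1 : 0ℚ ℚ.≤ D ℚ.- 1ℚ
    0≤D-1 = slack (⟨⟩-mono 1≤d)

    Dα+Bβ≡1 : D ℚ.* α ℚ.+ B ℚ.* β ≡ 1ℚ
    Dα+Bβ≡1 = begin
      D ℚ.* α ℚ.+ B ℚ.* β                        ≡⟨ solve 5 (λ p A B C D → D :* (p :* B :- A) :+ B :* (C :- p :* D) := C :* B :- A :* D) refl p A B C D ⟩
      C ℚ.* B ℚ.- A ℚ.* D                        ≡⟨ cong (ℚ._- A ℚ.* D) unimodular ⟩
      (1ℚ ℚ.+ A ℚ.* D) ℚ.- A ℚ.* D               ≡⟨ solve 2 (λ o x → (o :+ x) :- x := o) refl 1ℚ (A ℚ.* D) ⟩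
      1ℚ                                         ∎
      where open ≡-Reasoning

    -- Since ν + nμ = 1 and μ = sν, (n+1)μ = 1 + (s-1)ν, which is at least 1 because s ≥ 1.
    n<b+d⇒1≤[B+D]μ : n ℕ.< b + d → 1ℚ ℚ.≤ (B ℚ.+ D) ℚ.* μ
    n<b+d⇒1≤[B+D]μ n<b+d = ≤-slack
      (begin
        (B ℚ.+ D) ℚ.* μ
          ≡⟨ solve 5 (λ B D K S ν → (B :+ D) :* (S :* ν) := (ν :+ K :* (S :* ν)) :+ (((B :+ D) :- (con 1ℚ :+ K)) :* (S :* ν) :+ (S :- con 1ℚ) :* ν)) refl B D K S ν ⟩
        (ν ℚ.+ K ℚ.* μ) ℚ.+ (((B ℚ.+ D) ℚ.- (1ℚ ℚ.+ K)) ℚ.* μ ℚ.+ (S ℚ.- 1ℚ) ℚ.* ν)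
          ≡⟨ cong (ℚ._+ (((B ℚ.+ D) ℚ.- (1ℚ ℚ.+ K)) ℚ.* μ ℚ.+ (S ℚ.- 1ℚ) ℚ.* ν)) ν+Kμ≡1 ⟩
        1ℚ ℚ.+ (((B ℚ.+ D) ℚ.- (1ℚ ℚ.+ K)) ℚ.* μ ℚ.+ (S ℚ.- 1ℚ) ℚ.* ν)
          ∎)
      (0≤+ (0≤* (slack (subst₂ ℚ._≤_ (⟨⟩-+ 1 n) (⟨⟩-+ b d) (⟨⟩-mono n<b+d))) 0≤μ)
           (0≤* (slack (⟨⟩-mono 1≤s)) 0≤ν))
      where open ≡-Reasoning

    -- As D ≥ 1, the excess α-μ is at most D(α-μ) + B(β-μ) = 1 - (B+D)μ, which is not positive.
    n<b+d⇒α≤μ : n ℕ.< b + d → μ ℚ.≤ α → μ ℚ.≤ β → α ℚ.≤ μ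
    n<b+d⇒α≤μ n<b+d μ≤α μ≤β = ≤-slack
      (solve 5 (λ B D α β μ → μ := α :+ (((B :+ D) :* μ :- (D :* α :+ B :* β)) :+ ((D :- con 1ℚ) :* (α :- μ) :+ B :* (β :- μ)))) refl B D α β μ)
      (0≤+ (slack (subst (ℚ._≤ (B ℚ.+ D) ℚ.* μ) (sym Dα+Bβ≡1) (n<b+d⇒1≤[B+D]μ n<b+d)))
           (0≤+ (0≤* 0≤D-1 (slack μ≤α)) (0≤* (0≤⟨⟩ b) (slack μ≤β))))

    ν≡ : b + d ≡ n → ν ≡ D ℚ.* (α ℚ.- μ) ℚ.+ B ℚ.* (β ℚ.- μ)
    ν≡ b+d≡n = begin
      ν                                             ≡⟨ solve 2 (λ x y → x := (x :+ y) :- y) refl ν (K ℚ.* μ) ⟩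
      (ν ℚ.+ K ℚ.* μ) ℚ.- K ℚ.* μ                   ≡⟨ cong₂ (λ x y → x ℚ.- y ℚ.* μ) (trans ν+Kμ≡1 (sym Dα+Bβ≡1)) (trans (cong ⟨_⟩ (sym b+d≡n)) (⟨⟩-+ b d)) ⟩
      (D ℚ.* α ℚ.+ B ℚ.* β) ℚ.- (B ℚ.+ D) ℚ.* μ     ≡⟨ solve 5 (λ B D α β μ → (D :* α :+ B :* β) :- (B :+ D) :* μ := D :* (α :- μ) :+ B :* (β :- μ)) refl B D α β μ ⟩
      D ℚ.* (α ℚ.- μ) ℚ.+ B ℚ.* (β ℚ.- μ)           ∎
      where open ≡-Reasoning

    S*≤μ : ∀ {q} → q ℚ.≤ ν → S ℚ.* q ℚ.≤ μ
    S*≤μ {q} q≤ν = ≤-slack (solve 3 (λ S q ν → S :* ν := S :* q :+ S :* (ν :- q)) refl S q ν) (0≤* (0≤⟨⟩ s) (slack q≤ν))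

    last-close : b + d ≡ n → μ ℚ.≤ α → μ ℚ.≤ β → ∥ p ℚ.* ⟨ n * s ⟩ ∥ℚ ℚ.≤ μ
    last-close b+d≡n μ≤α μ≤β = begin
      ∥ p ℚ.* ⟨ n * s ⟩ ∥ℚ                                        ≤⟨ ∥p∥≤∣p-i∣ (p ℚ.* ⟨ n * s ⟩) (+ s ℤ.* (a ℤ.+ c)) ⟩
      ℚ.∣ p ℚ.* ⟨ n * s ⟩ ℚ.- fromℤ (+ s ℤ.* (a ℤ.+ c)) ∣
        ≡⟨ cong ℚ.∣_∣ (cong₂ (λ x y → p ℚ.* x ℚ.- y)
             (trans (⟨⟩-* n s) (cong (ℚ._* S) (trans (cong ⟨_⟩ (sym b+d≡n)) (⟨⟩-+ b d))))
             (trans (fromℤ-* (+ s) (a ℤ.+ c)) (cong (S ℚ.*_) (fromℤ-+ a c)))) ⟩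
      ℚ.∣ p ℚ.* ((B ℚ.+ D) ℚ.* S) ℚ.- S ℚ.* (A ℚ.+ C) ∣
        ≡⟨ cong ℚ.∣_∣ (solve 6 (λ p A B C D S → p :* ((B :+ D) :* S) :- S :* (A :+ C) := S :* ((p :* B :- A) :- (C :- p :* D))) refl p A B C D S) ⟩
      ℚ.∣ S ℚ.* (α ℚ.- β) ∣                                       ≤⟨ ∣-∣-≤ (S*≤μ α-β≤ν) (subst (ℚ._≤ μ) (solve 3 (λ S α β → S :* (β :- α) := :- (S :* (α :- β))) refl S α β) (S*≤μ β-α≤ν)) ⟩
      μ                                                           ∎
      where
      open ℚ.≤-Reasoning
      -- By `ν≡`, `ν` is a sum of the nonnegative excesses α-μ and β-μ with weights at least 1. It
      -- therefore dominates each excess, and so their difference in either order.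
      α-β≤ν : α ℚ.- β ℚ.≤ ν
      α-β≤ν = ≤-slack
        (trans (ν≡ b+d≡n) (solve 5 (λ B D α β μ → D :* (α :- μ) :+ B :* (β :- μ) := (α :- β) :+ ((D :- con 1ℚ) :* (α :- μ) :+ ((β :- μ) :+ B :* (β :- μ)))) refl B D α β μ))
        (0≤+ (0≤* 0≤D-1 (slack μ≤α)) (0≤+ (slack μ≤β) (0≤* (0≤⟨⟩ b) (slack μ≤β))))
      β-α≤ν : β ℚ.- α ℚ.≤ ν
      β-α≤ν = ≤-slack
        (trans (ν≡ b+d≡n) (solve 5 (λ B D α β μ → D :* (α :- μ) :+ B :* (β :- μ) := (β :- α) :+ ((B :- con 1ℚ) :* (β :- μ) :+ ((α :- μ) :+ D :* (α :- μ)))) refl B D α β μ))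
        (0≤+ (0≤* 0≤B-1 (slack μ≤β)) (0≤+ (slack μ≤α) (0≤* (0≤⟨⟩ d) (slack μ≤α))))

    byCases : Dec (α ℚ.≤ μ) → Dec (β ℚ.≤ μ) → ∃ λ v → v ∈ toList speeds × ∥ p ℚ.* ⟨ v ⟩ ∥ℚ ℚ.≤ μ
    byCases (yes α≤μ) _ = b , small∈speeds 1≤b b≤m ,
      ℚ.≤-trans (∥p∥≤∣p-i∣ (p ℚ.* B) a) (subst (ℚ._≤ μ) (sym (ℚ.0≤p⇒∣p∣≡p (slack a≤pb))) α≤μ)
    byCases (no _) (yes β≤μ) = d , small∈speeds 1≤d d≤m ,
      ℚ.≤-trans (∥p∥≤∣p-i∣ (p ℚ.* D) c)
        (subst (ℚ._≤ μ) (trans (sym (ℚ.0≤p⇒∣p∣≡p (slack pd≤c))) (∣p-q∣≡∣q-p∣ C (p ℚ.* D))) β≤μ)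
    -- At order n-1 the field `m<b+d` already reads n ≤ b+d, and n < b+d would give α ≤ μ; hence b+d
    -- = n.
    byCases (no α≰μ) (no β≰μ) = n * s , last∈speeds ,
      last-close (ℕ.≤-antisym (ℕ.≮⇒≥ λ n<b+d → α≰μ (n<b+d⇒α≤μ n<b+d μ≤α μ≤β)) m<b+d) μ≤α μ≤β
      where
      μ≤α = ℚ.<⇒≤ (ℚ.≰⇒> α≰μ)
      μ≤β = ℚ.<⇒≤ (ℚ.≰⇒> β≰μ)

  -- The bound holds for each rational approximant of `t`, so it passes to the reals term by term.
  loneliness≤μ : ∀ t k → seq (loneliness speeds t) k ℚ.≤ μ
  loneliness≤μ t k = let v , v∈ , v-close = ∃-close-speed (seq t k) in ℚ.≤-trans (loneliness≤ speeds t k v∈) v-close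

  -- Attainment at t = μ.

  -- Follows from 1 = ν + nμ and v+1 ≤ n. It keeps μv at least μ below 1, and for v = 1 it gives 2μ
  -- ≤ 1, used for the last speed.
  μv+μ≤1 : ∀ v → v ℕ.< n → μ ℚ.* ⟨ v ⟩ ℚ.+ μ ℚ.≤ 1ℚ
  μv+μ≤1 v v<n = ≤-slack
    (trans (sym ν+Kμ≡1) (solve 4 (λ ν K μ V → ν :+ K :* μ := (μ :* V :+ μ) :+ (ν :+ (K :- (con 1ℚ :+ V)) :* μ)) refl ν K μ ⟨ v ⟩))
    (0≤+ 0≤ν (0≤* (slack (subst (ℚ._≤ K) (⟨⟩-+ 1 v) (⟨⟩-mono v<n))) 0≤μ))

  μ≤∥μv∥ : ∀ {v} → 1 ℕ.≤ v → v ℕ.< n → μ ℚ.≤ ∥ μ ℚ.* ⟨ v ⟩ ∥ℚ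
  μ≤∥μv∥ {v} 1≤v v<n = ≤∥p∥ (+ 0)
    (≤-slack (solve 2 (λ μ V → μ :* V := (con 0ℚ :+ μ) :+ μ :* (V :- con 1ℚ)) refl μ ⟨ v ⟩)
      (0≤* 0≤μ (slack (⟨⟩-mono 1≤v))))
    (μv+μ≤1 v v<n)

  -- nsμ = s - μ lies between s - 1 + μ and s - μ.
  μ≤∥μns∥ : μ ℚ.≤ ∥ μ ℚ.* ⟨ n * s ⟩ ∥ℚ
  μ≤∥μns∥ = ≤∥p∥ (ℤ.pred (+ s))
    (≤-slack
      (begin
        μ ℚ.* ⟨ n * s ⟩                                     ≡⟨ solve 2 (λ x y → x := (x :+ y) :- y) refl _ μ ⟩
        (μ ℚ.* ⟨ n * s ⟩ ℚ.+ μ) ℚ.- μ                       ≡⟨ cong (ℚ._- μ) μns+μ≡S ⟩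
        S ℚ.- μ                                             ≡⟨ solve 2 (λ S μ → S :- μ := ((con (ℚ.- 1ℚ) :+ S) :+ μ) :+ (con 1ℚ :- (μ :* con 1ℚ :+ μ))) refl S μ ⟩
        ((ℚ.- 1ℚ ℚ.+ S) ℚ.+ μ) ℚ.+ (1ℚ ℚ.- (μ ℚ.* 1ℚ ℚ.+ μ))   ≡⟨ cong (λ x → (x ℚ.+ μ) ℚ.+ (1ℚ ℚ.- (μ ℚ.* 1ℚ ℚ.+ μ))) (fromℤ-+ ℤ.-1ℤ (+ s)) ⟨
        (fromℤ (ℤ.pred (+ s)) ℚ.+ μ) ℚ.+ (1ℚ ℚ.- (μ ℚ.* 1ℚ ℚ.+ μ))  ∎)
      (slack (μv+μ≤1 1 (s≤s (s≤s z≤n)))))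
    (ℚ.≤-reflexive (trans μns+μ≡S (cong fromℤ (sym (ℤ.suc-pred (+ s))))))
    where
    open ≡-Reasoning
    μns+μ≡S : μ ℚ.* ⟨ n * s ⟩ ℚ.+ μ ≡ S
    μns+μ≡S = begin
      μ ℚ.* ⟨ n * s ⟩ ℚ.+ μ          ≡⟨ cong (λ x → μ ℚ.* x ℚ.+ μ) (⟨⟩-* n s) ⟩
      μ ℚ.* (K ℚ.* S) ℚ.+ μ          ≡⟨ solve 3 (λ ν K S → (S :* ν) :* (K :* S) :+ S :* ν := S :* (ν :+ K :* (S :* ν))) refl ν K S ⟩
      S ℚ.* (ν ℚ.+ K ℚ.* μ)          ≡⟨ cong (S ℚ.*_) ν+Kμ≡1 ⟩
      S ℚ.* 1ℚ                       ≡⟨ ℚ.*-identityʳ S ⟩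
      S                              ∎

  μ≤loneliness : ∀ k → μ ℚ.≤ seq (loneliness speeds (fromℚ μ)) k
  μ≤loneliness k = ≤loneliness speeds (fromℚ μ) k
    (All.++⁺ (All.applyUpTo⁺₁ suc (suc m) (λ i<n-1 → μ≤∥μv∥ (s≤s z≤n) (s≤s i<n-1))) (μ≤∥μns∥ ∷ []))

  ML-speeds : ML speeds ≃ fromℚ μ
  ML-speeds = (fromℚ μ , ≤-antisym {f (fromℚ μ)} {fromℚ μ} (f≤μ (fromℚ μ)) (≤-pointwise {fromℚ μ} {f (fromℚ μ)} μ≤loneliness)) , f≤μ
    where
    f = loneliness speeds
    f≤μ : ∀ t → f t ≤ fromℚ μ
    f≤μ t = ≤-pointwise {f t} {fromℚ μ} (loneliness≤μ t)

theorem5p1 : ∀ (n s : ℕ) → n ≥ 2 → s ≥ 1 → ML (applyUpTo suc (n ∸ 1) ∷ʳ n * s) ≃ fromℚ (+ s / (1 + n * s))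
theorem5p1 n@(suc (suc m)) s (s≤s (s≤s _)) 1≤s =
  subst (λ μ → ML (applyUpTo suc (n ∸ 1) ∷ʳ n * s) ≃ fromℚ μ) (sym (/≡*1/ (+ s) (1 + n * s))) (ML-speeds m s 1≤s)
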